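{- For a positive integer $\Delta$, every graph $G$ with $n$ vertices and with maximum degree $\Delta$ satisfies $$\min\overline{R}(G)\leq O\!\left(n^{(\Delta+1)\lceil\log(\Delta+1)\rceil+1}\right),$$ where $\Delta$ is regarded as a constant (the implied constant may depend on $\Delta$ but not on $n$ or $G$).
   Context: All logarithms are base 2. An ordered graph is a pair $\mathcal{G}=(G,\prec)$ where $G$ is a (simple) graph and $\prec$ is a total ordering of its vertices; $\mathcal{G}$ is called an ordering of $G$. Two ordered graphs are isomorphic if there is a graph isomorphism between them preserving the vertex orderings. $\mathcal{K}_N$ denotes the (unique up to isomorphism) ordered complete graph on $N$ vertices. $\mathcal{G}=(G,\prec_1)$ is an ordered subgraph of $\mathcal{H}=(H,\prec_2)$ if $G$ is a subgraph of $H$ and $\prec_1$ is a suborder of $\prec_2$. The ordered Ramsey number $\overline{R}(\mathcal{G})$ is the minimum integer $N$ such that every $2$-coloring of the edges of $\mathcal{K}_N$ contains a monochromatic ordered subgraph isomorphic to $\mathcal{G}$. For a graph $G$, $\min\overline{R}(G):=\min\{\overline{R}(\mathcal{G}) : \mathcal{G}\text{ is an ordering of }G\}$. -}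

module Defs where

open import Level using (0ℓ)
open import Data.Nat using (ℕ; _≤_)
open import Data.Fin using (Fin; _<_)
open import Data.Fin.Properties using (_≟_; <-isStrictTotalOrder)
open import Data.Fin.Subset using (Subset; _∈_)
open import Data.List using (length; filter; map; allFin)
open import Data.List.Extrema.Nat using (max)
open import Data.Product using (Σ-syntax; ∃-syntax; _×_; proj₁)
open import Function.Bundles using (_↔_; _⇔_; Inverse)
open import Relation.Binary using (Rel; Decidable; Symmetric; IsStrictTotalOrder)
open import Relation.Binary.PropositionalEquality using (_≡_; _≢_; refl; ≢-sym)
open import Relation.Nullary using (¬_)
open import Relation.Nullary.Decidable using (¬?)

-- Adjacency is decidable, as it is classically for every graph.

record Graph (V : Set) : Set₁ where
  field
    Adj    : Rel V 0ℓ
    adj?   : Decidable Adj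
    symm   : Symmetric Adj
    irrefl : ∀ {v} → ¬ Adj v v

degree : ∀ {n} → Graph (Fin n) → Fin n → ℕ
degree {n} G v = length (filter (Graph.adj? G v) (allFin n))

maxDegree : ∀ {n} → Graph (Fin n) → ℕ
maxDegree {n} G = max 0 (map (degree G) (allFin n))

record TotalOrdering (V : Set) : Set₁ where
  field
    _≺_                : Rel V 0ℓ
    isStrictTotalOrder : IsStrictTotalOrder _≡_ _≺_

record OrderedGraph (V : Set) : Set₁ where
  constructor _,≺_
  field
    graph    : Graph V
    ordering : TotalOrdering V
  open Graph graph public
  open TotalOrdering ordering public

record _≅_ {V W : Set} (𝒢 : OrderedGraph V) (ℋ : OrderedGraph W) : Set where
  private
    module 𝒢 = OrderedGraph 𝒢
    module ℋ = OrderedGraph ℋ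
  field
    bijection : V ↔ W
  open Inverse bijection public using (to; from)
  field
    preserves-Adj : ∀ u v → 𝒢.Adj u v ⇔ ℋ.Adj (to u) (to v)
    preserves-≺   : ∀ u v → (u 𝒢.≺ v) ⇔ (to u ℋ.≺ to v)

𝒦 : ∀ N → OrderedGraph (Fin N)
𝒦 N = record
  { graph = record
    { Adj    = _≢_
    ; adj?   = λ u v → ¬? (u ≟ v)
    ; symm   = ≢-sym
    ; irrefl = λ v≢v → v≢v refl
    }
  ; ordering = record
    { _≺_                = _<_
    ; isStrictTotalOrder = <-isStrictTotalOrder
    }
  }

Element : ∀ {N} → Subset N → Set
Element {N} S = Σ[ v ∈ Fin N ] v ∈ S

-- 𝒮 is an ordered subgraph of ℋ with vertex set S; it need not be induced.

record _⊑_ {N} {S : Subset N}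
           (𝒮 : OrderedGraph (Element S)) (ℋ : OrderedGraph (Fin N)) : Set where
  private
    module 𝒮 = OrderedGraph 𝒮
    module ℋ = OrderedGraph ℋ
  field
    subgraph : ∀ {x y} → 𝒮.Adj x y → ℋ.Adj (proj₁ x) (proj₁ y)
    suborder : ∀ {x y} → x 𝒮.≺ y → proj₁ x ℋ.≺ proj₁ y

-- Symmetry is required for arbitrary proofs of adjacency, so it also makes
-- the colour of an edge independent of the proof that it is an edge.

record TwoColouring {V : Set} (G : Graph V) : Set where
  open Graph G
  field
    colour      : ∀ {u v} → Adj u v → Fin 2
    colour-symm : ∀ {u v} (e : Adj u v) (e′ : Adj v u) → colour e ≡ colour e′

Monochromatic : ∀ {N} {S : Subset N}
                {𝒮 : OrderedGraph (Element S)} {ℋ : OrderedGraph (Fin N)} →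
                TwoColouring (OrderedGraph.graph ℋ) → 𝒮 ⊑ ℋ → Set
Monochromatic {𝒮 = 𝒮} χ 𝒮⊑ℋ =
  ∃[ c ] (∀ {x y} (e : Adj x y) → colour (subgraph e) ≡ c)
  where
  open OrderedGraph 𝒮 using (Adj)
  open TwoColouring χ using (colour)
  open _⊑_ 𝒮⊑ℋ using (subgraph)

_⟶_ : ∀ {n} → ℕ → OrderedGraph (Fin n) → Set₁
N ⟶ 𝒢 =
  (χ : TwoColouring (OrderedGraph.graph (𝒦 N))) →
  Σ[ S ∈ Subset N ] Σ[ 𝒮 ∈ OrderedGraph (Element S) ] Σ[ 𝒮⊑𝒦 ∈ 𝒮 ⊑ 𝒦 N ]
    Monochromatic χ 𝒮⊑𝒦 × 𝒢 ≅ 𝒮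

IsMinimum : ∀ {ℓ} → (ℕ → Set ℓ) → ℕ → Set ℓ
IsMinimum P m = P m × (∀ k → P k → m ≤ k)

-- Ordered Ramsey numbers are encoded as relations: IsR̄ 𝒢 N says that the
-- ordered Ramsey number of 𝒢 is N, and IsMinR̄ G m that m is the minimum of
-- the ordered Ramsey numbers of the orderings of G.

IsR̄ : ∀ {n} → OrderedGraph (Fin n) → ℕ → Set₁
IsR̄ 𝒢 = IsMinimum (_⟶ 𝒢)

IsMinR̄ : ∀ {n} → Graph (Fin n) → ℕ → Set₁
IsMinR̄ {n} G =
  IsMinimum (λ N → Σ[ ≺ ∈ TotalOrdering (Fin n) ] IsR̄ (G ,≺ ≺) N)

{-# OPTIONS --safe #-}

-- Colour G greedily with Δ + 1 colours and list the vertices colour class by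
-- colour class, so that G sits inside every ordered complete multipartite graph
-- with 2 ^ L ≥ Δ + 1 parts of n consecutive vertices each.  By induction on ℓ,
-- every set of O(n ^ ((Δ + 1) ℓ + 1)) vertices contains a red copy of G or a blue
-- complete multipartite graph with 2 ^ ℓ such parts: chop the set into (Δ + 1) n
-- cells, one for each possible position of a vertex, and embed G in red greedily,
-- each embedded vertex shrinking the candidates for its neighbours by a factor
-- q = O(n).  If this gets stuck, there are large sets C and B, one preceding the
-- other, such that each vertex of C has red degree below ∣B∣ / q into B.  A blue
-- multipartite graph found in C has at most q / 2 vertices, so at least half of B
-- is joined to it entirely in blue, and the induction continues in that half.

module Submission where

open import Defs
open import Level using (0ℓ)
open import Data.Bool using (Bool; true; false)
import Data.Bool.Properties as Bool
open import Data.Nat using (ℕ; zero; suc; z≤n; s≤s; NonZero; >-nonZero⁻¹; ≢-nonZero⁻¹; ⌊_/2⌋; ⌈_/2⌉;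
  _+_; _*_; _∸_; _^_; _≤_; _≤?_; _<_)
open import Data.Nat.Properties as ℕ using (module ≤-Reasoning)
open import Data.Nat.Induction using (<-rec)
open import Data.Nat.Logarithm using (⌈log₂_⌉; ⌈log₂⌉-mono-≤; ⌈log₂⌈n/2⌉⌉≡⌈log₂n⌉∸1)
open import Data.Nat.Tactic.RingSolver using (solve-∀)
open import Data.Fin as Fin using (Fin; zero; suc; combine; toℕ)
open import Data.Fin.Properties as Fin using (any?; all?; pigeonhole)
open import Data.Fin.Subset using (Subset) renaming (_∈_ to _∈ˢ_)
open import Data.List using (List; []; _∷_; _++_; length; filter; map; take; drop; concat; lookup; allFin)
open import Data.List.Extrema.Nat using (xs≤max)
open import Data.List.Properties using (length-++; length-take; length-drop; take++drop≡id; length-map; length-tabulate)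
open import Data.List.Membership.Propositional using (_∈_; _∉_)
open import Data.List.Membership.Propositional.Properties
  using (∈-filter⁺; ∈-filter⁻; ∈-map⁺; ∈-lookup; ∈-concat⁺′; ∈-concat⁻′; ∈-allFin)
import Data.List.Membership.DecPropositional as DecMembership
open import Data.List.Relation.Unary.All as All using (All; []; _∷_)
open import Data.List.Relation.Unary.All.Properties as All using (all-filter)
open import Data.List.Relation.Unary.AllPairs using (AllPairs; []; _∷_)
open import Data.List.Relation.Unary.AllPairs.Properties as AllPairs using ()
open import Data.List.Relation.Unary.Any as Any using (here; there; index)
open import Data.List.Relation.Unary.Any.Properties using (lookup-index)
open import Data.List.Relation.Binary.Sublist.Propositional as Sublist
  using (_⊆_; []; _∷_; _∷ʳ_; ⊆-refl; ⊆-trans)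
open import Data.List.Relation.Binary.Sublist.Propositional.Properties as Sublist
  using (All-resp-⊆; filter-⊆; length-mono-≤; take-⊆; drop-⊆)
open import Data.Product using (Σ-syntax; ∃; ∃-syntax; ∃₂; _×_; _,_; proj₁; proj₂)
open import Data.Sum using (_⊎_; inj₁; inj₂)
open import Data.Vec as Vec using (Vec; []; _∷_; tabulate)
open import Data.Vec.Properties using (lookup∘tabulate; lookup⇒[]=; []=⇒lookup)
open import Data.Vec.Properties.WithK using ([]=-irrelevant)
open import Function using (_∘_; id; _⇔_; mk⇔; mk↔ₛ′; Equivalence)
open import Relation.Binary using (Rel; Symmetric; Trichotomous; IsStrictTotalOrder; tri<; tri≈; tri>)
  renaming (Decidable to Decidable₂)
open import Relation.Binary.Structures.Biased using (isStrictTotalOrderᶜ)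
open import Relation.Binary.PropositionalEquality
open import Relation.Nullary using (¬_; Dec; yes; no; does; contradiction)
open import Relation.Nullary.Decidable using (¬?; map′; decidable-stable; dec-true; _×-dec_; _⊎-dec_; _→-dec_)
open import Relation.Unary using (Pred; Decidable)

-- Lists: sublists, filtering and pigeonhole

AllPairs-resp-⊆ : ∀ {A : Set} {R : Rel A 0ℓ} {xs ys} → xs ⊆ ys → AllPairs R ys → AllPairs R xs
AllPairs-resp-⊆ []         []         = []
AllPairs-resp-⊆ (_ ∷ʳ τ)   (_ ∷ rs)   = AllPairs-resp-⊆ τ rs
AllPairs-resp-⊆ (refl ∷ τ) (r ∷ rs)   = All-resp-⊆ τ r ∷ AllPairs-resp-⊆ τ rs

AllPairs-++⁻ : ∀ {A : Set} {R : Rel A 0ℓ} xs {ys x y} →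
               AllPairs R (xs ++ ys) → x ∈ xs → y ∈ ys → R x y
AllPairs-++⁻ (_ ∷ xs) (r ∷ _)  (here refl)  y∈ys = All.lookup (All.++⁻ʳ xs r) y∈ys
AllPairs-++⁻ (_ ∷ xs) (_ ∷ rs) (there x∈xs) y∈ys = AllPairs-++⁻ xs rs x∈xs y∈ys

AllPairs-lookup : ∀ {A : Set} {R : Rel A 0ℓ} {xs} → AllPairs R xs →
                  ∀ {i j} → i Fin.< j → R (lookup xs i) (lookup xs j)
AllPairs-lookup {xs = _ ∷ xs} (r ∷ _)  {zero}  {suc j} _         = All.lookup r (∈-lookup {xs = xs} j)
AllPairs-lookup (_ ∷ rs) {suc i} {suc j} (s≤s i<j) = AllPairs-lookup rs i<j

length-filter-∁ : ∀ {A : Set} {P : Pred A 0ℓ} (P? : Decidable P) xs →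
                  length (filter P? xs) + length (filter (¬? ∘ P?) xs) ≡ length xs
length-filter-∁ P? []       = refl
length-filter-∁ P? (x ∷ xs) with P? x
... | yes _ = cong suc (length-filter-∁ P? xs)
... | no  _ = trans (ℕ.+-suc _ _) (cong suc (length-filter-∁ P? xs))

filter-mono-≤ : ∀ {A : Set} {P : Pred A 0ℓ} (P? : Decidable P) {xs ys} → xs ⊆ ys →
                length (filter P? xs) ≤ length (filter P? ys)
filter-mono-≤ P? xs⊆ys = length-mono-≤ (Sublist.filter⁺ P? P? (λ { refl → id }) xs⊆ys)

length-concat : ∀ {A : Set} {n} {xss : List (List A)} → All (λ xs → length xs ≡ n) xss →
                length (concat xss) ≡ length xss * n
length-concat []                        = refl
length-concat {xss = xs ∷ _} (refl ∷ eqs) = trans (length-++ xs) (cong (length xs +_) (length-concat eqs))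

fresh : ∀ {m} (xs : List (Fin m)) → length xs < m → ∃[ i ] i ∉ xs
fresh xs ∣xs∣<m with any? (λ i → ¬? (DecMembership._∈?_ Fin._≟_ i xs))
... | yes p = p
... | no ¬p =
  let i , j , i<j , eq = pigeonhole ∣xs∣<m (index ∘ member)
  in contradiction
    (trans (lookup-index (member i)) (trans (cong (lookup xs) eq) (sym (lookup-index (member j)))))
    (Fin.<⇒≢ i<j)
  where
  member : ∀ i → i ∈ xs
  member i = decidable-stable (DecMembership._∈?_ Fin._≟_ i xs) (λ i∉xs → ¬p (i , i∉xs))

-- Greedy choice: if every `w` spoils fewer than `t` elements of `C`, then all of `ws` together
-- cannot spoil the whole of `C`.
avoid : ∀ {A B : Set} {Bad : B → Pred A 0ℓ} (Bad? : ∀ w → Decidable (Bad w)) t ws C →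
        length ws * t < length C →
        (∃[ w ] w ∈ ws × ∃[ D ] D ⊆ C × t ≤ length D × All (Bad w) D) ⊎
        (∃[ x ] x ∈ C × (∀ {w} → w ∈ ws → ¬ Bad w x))
avoid Bad? t []       (x ∷ _) _ = inj₂ (x , here refl , λ ())
avoid Bad? t (w ∷ ws) C       h with t ≤? length (filter (Bad? w) C)
... | yes t≤ = inj₁ (w , here refl , filter (Bad? w) C , filter-⊆ (Bad? w) C , t≤ , all-filter (Bad? w) C)
... | no  t≰ with avoid Bad? t ws (filter (¬? ∘ Bad? w) C) h′
  where
  open ≤-Reasoning
  h′ : length ws * t < length (filter (¬? ∘ Bad? w) C)
  h′ = ℕ.+-cancelˡ-< t _ _ (begin-strict
    t + length ws * t                                              <⟨ h ⟩
    length C                                                       ≡⟨ length-filter-∁ (Bad? w) C ⟨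
    length (filter (Bad? w) C) + length (filter (¬? ∘ Bad? w) C)   ≤⟨ ℕ.+-monoˡ-≤ _ (ℕ.≰⇒≥ t≰) ⟩
    t + length (filter (¬? ∘ Bad? w) C)                            ∎)
... | inj₁ (w′ , w′∈ws , D , D⊆ , t≤ , bad) =
  inj₁ (w′ , there w′∈ws , D , ⊆-trans D⊆ (filter-⊆ (¬? ∘ Bad? w) C) , t≤ , bad)
... | inj₂ (x , x∈ , good) =
  let x∈C , ¬bad = ∈-filter⁻ (¬? ∘ Bad? w) x∈
  in inj₂ (x , x∈C , λ { (here refl) → ¬bad ; (there w∈ws) → good w∈ws })

-- Proper colourings

module Neighbours {n} (G : Graph (Fin n)) where
  open Graph G

  deg : List (Fin n) → Fin n → ℕ
  deg vs v = length (filter (adj? v) vs)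

  deg-∷-≤ : ∀ u vs v → deg vs v ≤ deg (u ∷ vs) v
  deg-∷-≤ u vs v = filter-mono-≤ (adj? v) (u ∷ʳ ⊆-refl)

  deg-∷-adj : ∀ {u v} vs → Adj v u → deg (u ∷ vs) v ≡ suc (deg vs v)
  deg-∷-adj {u} {v} vs a with adj? v u
  ... | yes _ = refl
  ... | no ¬a = contradiction a ¬a

  -- Greedy colouring: the head has at most `Δ` neighbours in the tail, and these cannot use up
  -- `Δ + 1` colours.
  properColouring : ∀ {Δ} vs → (∀ v → deg vs v ≤ Δ) →
                    Σ[ c ∈ (Fin n → Fin (suc Δ)) ]
                      (∀ {u v} → u ∈ vs → v ∈ vs → Adj u v → c u ≢ c v)
  properColouring []       _   = (λ _ → zero) , λ ()
  properColouring {Δ} (v ∷ vs) bound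
    with c , proper ← properColouring vs (λ u → ℕ.≤-trans (deg-∷-≤ v vs u) (bound u))
    with i , i∉ ← fresh (map c (filter (adj? v) vs))
                    (s≤s (ℕ.≤-trans (ℕ.≤-reflexive (length-map c (filter (adj? v) vs)))
                           (ℕ.≤-trans (deg-∷-≤ v vs v) (bound v))))
    = c′ , proper′
    where
    c′ : Fin n → Fin (suc Δ)
    c′ w with w Fin.≟ v
    ... | yes _ = i
    ... | no  _ = c w

    used : ∀ {u} → u ∈ vs → Adj v u → i ≢ c u
    used u∈vs a refl = i∉ (∈-map⁺ c (∈-filter⁺ (adj? v) u∈vs a))

    proper′ : ∀ {u w} → u ∈ v ∷ vs → w ∈ v ∷ vs → Adj u w → c′ u ≢ c′ w
    proper′ {u} {w} u∈ w∈ a with u Fin.≟ v | w Fin.≟ v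
    ... | yes refl | yes refl = contradiction a irrefl
    ... | yes refl | no w≢v   = used (Any.tail w≢v w∈) a
    ... | no u≢v   | yes refl = ≢-sym (used (Any.tail u≢v u∈) (symm a))
    ... | no u≢v   | no w≢v   = proper (Any.tail u≢v u∈) (Any.tail w≢v w∈) a

-- Red embeddings and sparse pairs

module Host {N} {Red : Rel (Fin N) 0ℓ} (red? : Decidable₂ Red) (Red-sym : Symmetric Red) where

  _≪_ : Rel (List (Fin N)) 0ℓ
  C ≪ B = ∀ {x y} → x ∈ C → y ∈ B → x Fin.< y

  ≪-resp-⊆ : ∀ {C C′ B B′} → C′ ⊆ C → B′ ⊆ B → C ≪ B → C′ ≪ B′
  ≪-resp-⊆ C′⊆C B′⊆B C≪B x∈ y∈ = C≪B (Sublist.lookup C′⊆C x∈) (Sublist.lookup B′⊆B y∈)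

  Sorted : Pred (List (Fin N)) 0ℓ
  Sorted = AllPairs Fin._<_

  redDeg : List (Fin N) → Fin N → ℕ
  redDeg B x = length (filter (red? x) B)

  -- Red density into `B` below 1 / `q`, cleared of division.
  Sparse : ℕ → List (Fin N) → Pred (Fin N) 0ℓ
  Sparse q B x = redDeg B x * q < length B

  -- Cells are consecutive blocks of a sorted list, so vertices picked from distinct cells come in
  -- the order of the cells.
  chunks : ∀ m s A → Sorted A → m * s ≤ length A →
           Σ[ cell ∈ (Fin m → List (Fin N)) ]
             (∀ k → cell k ⊆ A) × (∀ k → s ≤ length (cell k)) × (∀ {j k} → j Fin.< k → cell j ≪ cell k)
  chunks zero    s A _      _ = (λ ()) , (λ ()) , (λ ()) , λ { {()} }
  chunks (suc m) s A sorted h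
    with cell , cell⊆ , long , ordered ← chunks m s (drop s A) (AllPairs.drop⁺ s sorted)
           (subst (m * s ≤_) (sym (length-drop s A)) (ℕ.m+n≤o⇒m≤o∸n (m * s) (subst (_≤ length A) (ℕ.+-comm s (m * s)) h)))
    = cell′ , cell′⊆ , long′ , ordered′
    where
    cell′ : Fin (suc m) → List (Fin N)
    cell′ zero    = take s A
    cell′ (suc k) = cell k

    cell′⊆ : ∀ k → cell′ k ⊆ A
    cell′⊆ zero    = take-⊆ s A
    cell′⊆ (suc k) = ⊆-trans (cell⊆ k) (drop-⊆ s A)

    long′ : ∀ k → s ≤ length (cell′ k)
    long′ zero    = ℕ.≤-reflexive (sym (trans (length-take s A) (ℕ.m≤n⇒m⊓n≡m (ℕ.m+n≤o⇒m≤o s h))))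
    long′ (suc k) = long k

    ordered′ : ∀ {j k} → j Fin.< k → cell′ j ≪ cell′ k
    ordered′ {zero}  {suc k} _         x∈ y∈ =
      AllPairs-++⁻ (take s A) (subst Sorted (sym (take++drop≡id s A)) sorted) x∈ (Sublist.lookup (cell⊆ k) y∈)
    ordered′ {suc j} {suc k} (s≤s j<k) x∈ y∈ = ordered j<k x∈ y∈

  -- Each `x` removes fewer than `length B` / `q` vertices from `B`; the size estimate adds this up,
  -- multiplied by `q`.
  clean : ∀ q xs B → All (Sparse q B) xs →
          ∃[ B′ ] B′ ⊆ B × length B * q ≤ length B′ * q + length xs * length B ×
                  (∀ {x y} → x ∈ xs → y ∈ B′ → ¬ Red x y)
  clean q []       B []              = B , ⊆-refl , ℕ.m≤m+n _ _ , λ ()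
  clean q (x ∷ xs) B (sparse ∷ rest) with B′ , B′⊆B , large , blue ← clean q xs B rest =
    filter (¬? ∘ red? x) B′ , ⊆-trans (filter-⊆ (¬? ∘ red? x) B′) B′⊆B , large′ , λ where
      (here refl) y∈ → proj₂ (∈-filter⁻ (¬? ∘ red? x) {xs = B′} y∈)
      (there x∈)  y∈ → blue x∈ (proj₁ (∈-filter⁻ (¬? ∘ red? x) y∈))
    where
    open ≤-Reasoning
    b = length B
    b″ = length (filter (¬? ∘ red? x) B′)
    large′ : b * q ≤ b″ * q + (b + length xs * b)
    large′ = begin
      b * q
        ≤⟨ large ⟩
      length B′ * q + length xs * b
        ≡⟨ cong (λ k → k * q + length xs * b) (length-filter-∁ (red? x) B′) ⟨
      (redDeg B′ x + b″) * q + length xs * b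
        -- Sparsity is known against all of `B`; the sublist `B′` has no more red neighbours of `x`.
        ≤⟨ ℕ.+-monoˡ-≤ _ (ℕ.*-monoˡ-≤ q (ℕ.+-monoˡ-≤ b″ (filter-mono-≤ (red? x) B′⊆B))) ⟩
      (redDeg B x + b″) * q + length xs * b
        ≡⟨ cong (_+ length xs * b) (trans (ℕ.*-distribʳ-+ q (redDeg B x) b″) (ℕ.+-comm (redDeg B x * q) _)) ⟩
      b″ * q + redDeg B x * q + length xs * b
        ≡⟨ ℕ.+-assoc (b″ * q) _ _ ⟩
      b″ * q + (redDeg B x * q + length xs * b)
        ≤⟨ ℕ.+-monoʳ-≤ (b″ * q) (ℕ.+-monoˡ-≤ _ (ℕ.<⇒≤ sparse)) ⟩
      b″ * q + (b + length xs * b)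
        ∎

  module RedEmbedding {n} (G : Graph (Fin n)) (q : ℕ) .{{_ : NonZero q}} where
    open Graph G
    open Neighbours G

    -- Adjacency makes `v` and `w` distinct, which later puts `C` and `B` into different cells.
    SparsePair : ℕ → (Fin n → List (Fin N)) → Set
    SparsePair t cand = ∃₂ λ v w → Adj v w × ∃₂ λ C B →
      C ⊆ cand v × B ⊆ cand w × t ≤ length C × t ≤ length B × All (Sparse q B) C

    RedEmbeddingInto : List (Fin n) → (Fin n → List (Fin N)) → Set
    RedEmbeddingInto vs cand = Σ[ f ∈ (Fin n → Fin N) ]
      (∀ {v} → v ∈ vs → f v ∈ cand v) × (∀ {u v} → u ∈ vs → v ∈ vs → Adj u v → Red (f u) (f v))

    -- The exponent counts only the neighbours of v still to be embedded: each
    -- neighbour that gets embedded lowers it by one and costs a factor at most q.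
    redEmbedding : ∀ {Δ} t vs cand → 1 ≤ t → (∀ v → degree G v ≤ Δ) →
                   (∀ v → suc Δ * t * q ^ deg vs v ≤ length (cand v)) →
                   SparsePair t cand ⊎ RedEmbeddingInto vs cand
    redEmbedding {Δ} t vs cand 1≤t bound large = go vs cand large
      where
      open ≤-Reasoning
      T = suc Δ * t

      T≤ : ∀ k {m} → T * q ^ k ≤ m → T ≤ m
      T≤ k h = ℕ.≤-trans (ℕ.≤-reflexive (sym (ℕ.*-identityʳ T)))
                 (ℕ.≤-trans (ℕ.*-monoʳ-≤ T (ℕ.m^n>0 q k)) h)

      T>Δ*t : Δ * t < T
      T>Δ*t = ℕ.+-monoˡ-≤ (Δ * t) 1≤t

      go : ∀ vs cand → (∀ v → T * q ^ deg vs v ≤ length (cand v)) → SparsePair t cand ⊎ RedEmbeddingInto vs cand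
      go [] cand large = inj₂ (f , (λ ()) , λ ())
        where
        f : Fin n → Fin N
        -- No vertex is left to embed, so these are default values; a head exists because every
        -- candidate list has more than `Δ * t` elements.
        f v with cand v | ℕ.<-≤-trans T>Δ*t (T≤ 0 (large v))
        ... | x ∷ _ | _ = x
      go (v ∷ vs) cand large
        -- An `x` is bad for a neighbour `w` if it would shrink `cand w` by more than a factor `q`.
        -- Neighbours already embedded are tested too, as their lists also stay large, so the number
        -- of tests is the full degree of `v`, at most `Δ`.
        with avoid (λ w x → redDeg (cand w) x * q ℕ.<? length (cand w)) t (filter (adj? v) (allFin n)) (cand v)
               (ℕ.≤-<-trans (ℕ.*-monoˡ-≤ t (bound v)) (ℕ.<-≤-trans T>Δ*t (T≤ (deg (v ∷ vs) v) (large v))))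
      ... | inj₁ (w , w∈ , C , C⊆ , t≤ , sparse) =
        inj₁ (v , w , proj₂ (∈-filter⁻ (adj? v) {xs = allFin n} w∈) , C , cand w , C⊆ , ⊆-refl , t≤ ,
              ℕ.≤-trans (ℕ.m≤m+n t (Δ * t)) (T≤ (deg (v ∷ vs) w) (large w)) , sparse)
      ... | inj₂ (x , x∈ , dense) = conclude (go vs cand′ large′)
        where
        cand′ : Fin n → List (Fin N)
        cand′ w with adj? v w
        ... | yes _ = filter (red? x) (cand w)
        ... | no  _ = cand w

        cand′⊆ : ∀ w → cand′ w ⊆ cand w
        cand′⊆ w with adj? v w
        ... | yes _ = filter-⊆ (red? x) (cand w)
        ... | no  _ = ⊆-refl

        cand′-red : ∀ {w y} → Adj v w → y ∈ cand′ w → Red x y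
        cand′-red {w} a y∈ with adj? v w
        ... | yes _ = proj₂ (∈-filter⁻ (red? x) {xs = cand w} y∈)
        ... | no ¬a = contradiction a ¬a

        large′ : ∀ w → T * q ^ deg vs w ≤ length (cand′ w)
        large′ w with adj? v w
        ... | no  _ = ℕ.≤-trans (ℕ.*-monoʳ-≤ T (ℕ.^-monoʳ-≤ q (deg-∷-≤ v vs w))) (large w)
        ... | yes a = ℕ.*-cancelʳ-≤ _ _ q (begin
          T * q ^ deg vs w * q       ≡⟨ ℕ.*-assoc T _ q ⟩
          T * (q ^ deg vs w * q)     ≡⟨ cong (T *_) (ℕ.*-comm _ q) ⟩
          T * q ^ suc (deg vs w)     ≡⟨ cong (λ k → T * q ^ k) (deg-∷-adj vs (symm a)) ⟨
          T * q ^ deg (v ∷ vs) w     ≤⟨ large w ⟩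
          length (cand w)            ≤⟨ ℕ.≮⇒≥ (dense (∈-filter⁺ (adj? v) (∈-allFin w) a)) ⟩
          redDeg (cand w) x * q      ∎)

        conclude : SparsePair t cand′ ⊎ RedEmbeddingInto vs cand′ → SparsePair t cand ⊎ RedEmbeddingInto (v ∷ vs) cand
        conclude (inj₁ (u , w , a , C , B , C⊆ , B⊆ , rest)) =
          inj₁ (u , w , a , C , B , ⊆-trans C⊆ (cand′⊆ u) , ⊆-trans B⊆ (cand′⊆ w) , rest)
        conclude (inj₂ (f , f∈ , f-red)) = inj₂ (f′ , f′∈ , f′-red)
          where
          f′ : Fin n → Fin N
          f′ w with w Fin.≟ v
          ... | yes _ = x
          ... | no  _ = f w

          f′∈ : ∀ {w} → w ∈ v ∷ vs → f′ w ∈ cand w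
          f′∈ {w} w∈ with w Fin.≟ v
          ... | yes refl = x∈
          ... | no w≢v   = Sublist.lookup (cand′⊆ w) (f∈ (Any.tail w≢v w∈))

          f′-red : ∀ {u w} → u ∈ v ∷ vs → w ∈ v ∷ vs → Adj u w → Red (f′ u) (f′ w)
          f′-red {u} {w} u∈ w∈ a with u Fin.≟ v | w Fin.≟ v
          ... | yes refl | yes refl = contradiction a irrefl
          ... | yes refl | no w≢v   = cand′-red a (f∈ (Any.tail w≢v w∈))
          ... | no u≢v   | yes refl = Red-sym (cand′-red (symm a) (f∈ (Any.tail u≢v u∈)))
          ... | no u≢v   | no w≢v   = f-red (Any.tail u≢v u∈) (Any.tail w≢v w∈) a

-- Red copies and blue multipartite graphs

module Dichotomy {n Δ} .{{_ : NonZero n}} (G : Graph (Fin n)) (bound : ∀ v → degree G v ≤ Δ)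
                 (c : Fin n → Fin (suc Δ)) (proper : ∀ {u v} → Graph.Adj G u v → c u ≢ c v)
                 (L : ℕ) where
  open Graph G
  open Neighbours G

  -- Twice the number of vertices in `2 ^ L` parts of size `n`, as `halving` requires.
  q : ℕ
  q = 2 ^ suc L * n

  instance
    q≢0 : NonZero q
    q≢0 = ℕ.m*n≢0 (2 ^ suc L) n {{ℕ.m^n≢0 2 (suc L)}}

  -- The size that `redEmbedding` asks for while as many as `Δ` neighbours are still to be embedded.
  cellSize : ℕ → ℕ
  cellSize t = suc Δ * t * q ^ Δ

  -- The factor 2 makes up for the half of B that is discarded.
  hostSize : ℕ → ℕ
  hostSize zero    = n
  hostSize (suc ℓ) = suc Δ * n * cellSize (2 * hostSize ℓ)

  hostSize>0 : ∀ ℓ → 1 ≤ hostSize ℓ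
  hostSize>0 zero    = >-nonZero⁻¹ n
  hostSize>0 (suc ℓ) = ℕ.*-mono-≤ (ℕ.*-mono-≤ (s≤s (z≤n {Δ})) (hostSize>0 0))
    (ℕ.*-mono-≤ (ℕ.*-mono-≤ (s≤s (z≤n {Δ})) (ℕ.*-mono-≤ (s≤s (z≤n {1})) (hostSize>0 ℓ))) (ℕ.m^n>0 q Δ))

  -- Lexicographic position: colour class first, vertex number second. It fixes both the ordering of
  -- `G` and the cell of each vertex.
  key : Fin n → Fin (suc Δ * n)
  key v = combine (c v) v

  -- With `x` / `q` at most 1/2, the last hypothesis gives `b` ≤ `b′` + `b` / 2.
  halving : ∀ b b′ x → 2 * x ≤ q → b * q ≤ b′ * q + x * b → b ≤ 2 * b′
  halving b b′ x 2x≤q h = ℕ.*-cancelʳ-≤ b (2 * b′) q (ℕ.+-cancelʳ-≤ (b * q) _ _ (begin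
    b * q + b * q             ≡⟨ cong (b * q +_) (ℕ.+-identityʳ (b * q)) ⟨
    2 * (b * q)               ≤⟨ ℕ.*-monoʳ-≤ 2 h ⟩
    2 * (b′ * q + x * b)      ≡⟨ ℕ.*-distribˡ-+ 2 (b′ * q) (x * b) ⟩
    2 * (b′ * q) + 2 * (x * b)  ≡⟨ cong₂ _+_ (ℕ.*-assoc 2 b′ q) (trans (ℕ.*-comm b (2 * x)) (ℕ.*-assoc 2 x b)) ⟨
    2 * b′ * q + b * (2 * x)  ≤⟨ ℕ.+-monoʳ-≤ (2 * b′ * q) (ℕ.*-monoʳ-≤ b 2x≤q) ⟩
    2 * b′ * q + b * q        ∎))
    where open ≤-Reasoning

  module _ {N} {Red : Rel (Fin N) 0ℓ} (red? : Decidable₂ Red) (Red-sym : Symmetric Red) where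
    open Host red? Red-sym
    open RedEmbedding G q

    Copy : Rel (Fin N) 0ℓ → Set
    Copy P = Σ[ f ∈ (Fin n → Fin N) ]
      (∀ {u v} → key u Fin.< key v → f u Fin.< f v) × (∀ {u v} → Adj u v → P (f u) (f v))

    -- Parts are listed from left to right. Edges inside a part may have any colour, since colour
    -- classes of `G` are independent.
    BluePartite : ℕ → List (Fin N) → Set
    BluePartite k A = ∃[ Ps ] length Ps ≡ k × All (_⊆ A) Ps × All (λ P → length P ≡ n) Ps ×
      AllPairs (λ P Q → ∀ {x y} → x ∈ P → y ∈ Q → x Fin.< y × ¬ Red x y) Ps

    -- Sparsity runs from `C` to `B`, while either list may come first in the order.
    SparseSplit : ℕ → List (Fin N) → Set
    SparseSplit t A = ∃₂ λ C B → C ⊆ A × B ⊆ A × t ≤ length C × t ≤ length B ×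
      All (Sparse q B) C × (C ≪ B ⊎ B ≪ C)

    -- Each `v` is sought in the cell with index `key v`. Images in these cells are automatically
    -- ordered by `key`, so a red embedding is a red copy.
    redCopy⊎sparseSplit : ∀ t A → Sorted A → 1 ≤ t → suc Δ * n * cellSize t ≤ length A →
                          Copy Red ⊎ SparseSplit t A
    redCopy⊎sparseSplit t A sorted 1≤t h
      with cell , cell⊆ , long , ordered ← chunks (suc Δ * n) (cellSize t) A sorted h
      with redEmbedding t (allFin n) (cell ∘ key) 1≤t bound
             (λ v → ℕ.≤-trans (ℕ.*-monoʳ-≤ (suc Δ * t) (ℕ.^-monoʳ-≤ q (bound v))) (long (key v)))
    ... | inj₂ (f , f∈ , f-red) =
      inj₁ (f , (λ k< → ordered k< (f∈ (∈-allFin _)) (f∈ (∈-allFin _))) , f-red (∈-allFin _) (∈-allFin _))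
    ... | inj₁ (v , w , a , C , B , C⊆ , B⊆ , t≤C , t≤B , sparse) =
      inj₂ (C , B , ⊆-trans C⊆ (cell⊆ (key v)) , ⊆-trans B⊆ (cell⊆ (key w)) , t≤C , t≤B , sparse , order)
      where
      order : C ≪ B ⊎ B ≪ C
      order with Fin.<-cmp (key v) (key w)
      ... | tri< v<w _ _ = inj₁ (≪-resp-⊆ C⊆ B⊆ (ordered v<w))
      -- A key determines its vertex, so equal keys would make `v` adjacent to itself.
      ... | tri≈ _ v≡w _ = contradiction (subst (Adj v) (sym (Fin.combine-injectiveʳ (c v) v (c w) w v≡w)) a) irrefl
      ... | tri> _ _ w<v = inj₂ (≪-resp-⊆ B⊆ C⊆ (ordered w<v))

    -- The call in `C` comes first: its parts decide which vertices `clean` deletes from `B`, and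
    -- the second call runs on what is left. The bound `ℓ ≤ L` lets one `q` serve all levels.
    redCopy⊎bluePartite : ∀ ℓ → ℓ ≤ L → ∀ A → Sorted A → hostSize ℓ ≤ length A →
                          Copy Red ⊎ BluePartite (2 ^ ℓ) A
    redCopy⊎bluePartite zero    _    A _      h =
      inj₂ (take n A ∷ [] , refl , take-⊆ n A ∷ [] ,
            trans (length-take n A) (ℕ.m≤n⇒m⊓n≡m h) ∷ [] , [] ∷ [])
    redCopy⊎bluePartite (suc ℓ) ℓ<L A sorted h
      with redCopy⊎sparseSplit (2 * hostSize ℓ) A sorted (ℕ.*-mono-≤ (s≤s (z≤n {1})) (hostSize>0 ℓ)) h
    ... | inj₁ copy = inj₁ copy
    ... | inj₂ (C , B , C⊆ , B⊆ , large-C , large-B , sparse , order)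
      with redCopy⊎bluePartite ℓ (ℕ.<⇒≤ ℓ<L) C (AllPairs-resp-⊆ C⊆ sorted)
             (ℕ.≤-trans (ℕ.m≤m+n (hostSize ℓ) _) large-C)
    ... | inj₁ copy = inj₁ copy
    ... | inj₂ (Ps , ∣Ps∣ , Ps⊆ , ∣P∣ , blue-Ps)
      with B′ , B′⊆ , large , blue ← clean q (concat Ps) B
             (All.tabulate (λ x∈ → let _ , x∈P , P∈ = ∈-concat⁻′ Ps x∈ in
                            All.lookup sparse (Sublist.lookup (All.lookup Ps⊆ P∈) x∈P)))
      with redCopy⊎bluePartite ℓ (ℕ.<⇒≤ ℓ<L) B′ (AllPairs-resp-⊆ (⊆-trans B′⊆ B⊆) sorted)
             -- The factor 2 in the size of `B` is spent here: `2 * hostSize ℓ ≤ length B ≤ 2 *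
             -- length B′`.
             (ℕ.*-cancelˡ-≤ 2 (ℕ.≤-trans large-B (halving (length B) (length B′) (length (concat Ps)) few large)))
      where
      open ≤-Reasoning
      few : 2 * length (concat Ps) ≤ q
      few = begin
        2 * length (concat Ps)  ≡⟨ cong (2 *_) (trans (length-concat ∣P∣) (cong (_* n) ∣Ps∣)) ⟩
        2 * (2 ^ ℓ * n)         ≤⟨ ℕ.*-monoʳ-≤ 2 (ℕ.*-monoˡ-≤ n (ℕ.^-monoʳ-≤ 2 (ℕ.<⇒≤ ℓ<L))) ⟩
        2 * (2 ^ L * n)         ≡⟨ ℕ.*-assoc 2 (2 ^ L) n ⟨
        q                       ∎
    ... | inj₁ copy = inj₁ copy
    ... | inj₂ (Qs , ∣Qs∣ , Qs⊆ , ∣Q∣ , blue-Qs) = inj₂ (join order)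
      where
      Ps⊆A : All (_⊆ A) Ps
      Ps⊆A = All.map (λ P⊆ → ⊆-trans P⊆ C⊆) Ps⊆
      Qs⊆A : All (_⊆ A) Qs
      Qs⊆A = All.map (λ Q⊆ → ⊆-trans Q⊆ (⊆-trans B′⊆ B⊆)) Qs⊆

      double : ∀ (xs ys : List (List (Fin N))) → length xs ≡ 2 ^ ℓ → length ys ≡ 2 ^ ℓ →
               length (xs ++ ys) ≡ 2 ^ suc ℓ
      double xs _ p r = trans (length-++ xs) (cong₂ _+_ p (trans r (sym (ℕ.+-identityʳ _))))

      cross : ∀ {P Q x y} → P ∈ Ps → Q ∈ Qs → x ∈ P → y ∈ Q → x ∈ C × y ∈ B × ¬ Red x y
      cross P∈ Q∈ x∈ y∈ =
        let y∈B′ = Sublist.lookup (All.lookup Qs⊆ Q∈) y∈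
        in Sublist.lookup (All.lookup Ps⊆ P∈) x∈ , Sublist.lookup B′⊆ y∈B′ , blue (∈-concat⁺′ x∈ P∈) y∈B′

      join : C ≪ B ⊎ B ≪ C → BluePartite (2 ^ suc ℓ) A
      join (inj₁ C≪B) = Ps ++ Qs , double Ps Qs ∣Ps∣ ∣Qs∣ , All.++⁺ Ps⊆A Qs⊆A , All.++⁺ ∣P∣ ∣Q∣ ,
        AllPairs.++⁺ blue-Ps blue-Qs (All.tabulate (λ P∈ → All.tabulate (λ Q∈ x∈ y∈ →
          let x∈C , y∈B , ¬red = cross P∈ Q∈ x∈ y∈ in C≪B x∈C y∈B , ¬red)))
      -- The parts from `B` now come first, so the blue pairs are reversed by `Red-sym`.
      join (inj₂ B≪C) = Qs ++ Ps , double Qs Ps ∣Qs∣ ∣Ps∣ , All.++⁺ Qs⊆A Ps⊆A , All.++⁺ ∣Q∣ ∣P∣ ,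
        AllPairs.++⁺ blue-Qs blue-Ps (All.tabulate (λ Q∈ → All.tabulate (λ P∈ y∈ x∈ →
          let x∈C , y∈B , ¬red = cross P∈ Q∈ x∈ y∈ in B≪C y∈B x∈C , ¬red ∘ Red-sym)))

    -- Colour class `i` goes into the part with index `i`, and `v` to position `v` among its `n`
    -- places. Every edge joins two colours, hence two parts, and is blue; `f` follows the same
    -- lexicographic order as `key`.
    bluePartite⇒blueCopy : ∀ {k A} → Sorted A → suc Δ ≤ k → BluePartite k A → Copy (λ x y → ¬ Red x y)
    bluePartite⇒blueCopy sorted p≤k (Ps , refl , Ps⊆ , ∣P∣ , blue) = f , f-mono , f-blue
      where
      part : Fin (suc Δ) → List (Fin N)
      part i = lookup Ps (Fin.inject≤ i p≤k)

      part∈ : ∀ i → part i ∈ Ps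
      part∈ i = ∈-lookup {xs = Ps} (Fin.inject≤ i p≤k)

      vertex : ∀ i → Fin n → Fin (length (part i))
      vertex i = Fin.cast (sym (All.lookup ∣P∣ (part∈ i)))

      f : Fin n → Fin N
      f v = lookup (part (c v)) (vertex (c v) v)

      across : ∀ {u v} → c u Fin.< c v → f u Fin.< f v × ¬ Red (f u) (f v)
      across {u} {v} cu<cv = AllPairs-lookup blue
        (subst₂ _<_ (sym (Fin.toℕ-inject≤ (c u) p≤k)) (sym (Fin.toℕ-inject≤ (c v) p≤k)) cu<cv)
        (∈-lookup {xs = part (c u)} (vertex (c u) u)) (∈-lookup {xs = part (c v)} (vertex (c v) v))

      within : ∀ i {u v} → u Fin.< v → lookup (part i) (vertex i u) Fin.< lookup (part i) (vertex i v)
      within i {u} {v} u<v = AllPairs-lookup (AllPairs-resp-⊆ (All.lookup Ps⊆ (part∈ i)) sorted)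
        (subst₂ _<_ (sym (Fin.toℕ-cast _ u)) (sym (Fin.toℕ-cast _ v)) u<v)

      f-mono : ∀ {u v} → key u Fin.< key v → f u Fin.< f v
      f-mono {u} {v} k< with Fin.<-cmp (c u) (c v)
      ... | tri< cu<cv _ _ = proj₁ (across {u} {v} cu<cv)
      ... | tri> _ _ cv<cu = contradiction (Fin.combine-monoˡ-< v u cv<cu) (Fin.<-asym k<)
      -- The common summand `n * toℕ (c u)` of both keys cancels, leaving the order of `u` and `v`.
      ... | tri≈ _ cu≡cv _ = subst (λ i → f u Fin.< lookup (part i) (vertex i v)) cu≡cv
        (within (c u) (ℕ.+-cancelˡ-< (n * toℕ (c u)) _ _ (subst₂ _<_ (Fin.toℕ-combine (c u) u)
          (trans (Fin.toℕ-combine (c v) v) (cong (λ i → n * toℕ i + toℕ v) (sym cu≡cv))) k<)))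

      f-blue : ∀ {u v} → Adj u v → ¬ Red (f u) (f v)
      f-blue {u} {v} a with Fin.<-cmp (c u) (c v)
      ... | tri< cu<cv _ _ = proj₂ (across {u} {v} cu<cv)
      ... | tri≈ _ cu≡cv _ = contradiction cu≡cv (proper a)
      ... | tri> _ _ cv<cu = proj₂ (across {v} {u} cv<cu) ∘ Red-sym

    redCopy⊎blueCopy : suc Δ ≤ 2 ^ L → hostSize L ≤ N → Copy Red ⊎ Copy (λ x y → ¬ Red x y)
    redCopy⊎blueCopy p≤2^L h
      with redCopy⊎bluePartite L ℕ.≤-refl (allFin N) (AllPairs.tabulate⁺-< id)
             (ℕ.≤-trans h (ℕ.≤-reflexive (sym (length-tabulate id))))
    ... | inj₁ copy = inj₁ copy
    ... | inj₂ partite = inj₂ (bluePartite⇒blueCopy (AllPairs.tabulate⁺-< id) p≤2^L partite)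

-- Existence of the minimum ordered Ramsey number

minimum : ∀ {P : Pred ℕ 0ℓ} → Decidable P → ∀ b → P b → ∃[ m ] IsMinimum P m
minimum P? zero    p = 0 , p , λ _ _ → z≤n
minimum {P} P? (suc b) p with P? 0
... | yes p₀ = 0 , p₀ , λ _ _ → z≤n
... | no ¬p₀ with m , pₘ , least ← minimum (P? ∘ suc) b p = suc m , pₘ , least′
  where
  least′ : ∀ k → P k → suc m ≤ k
  least′ zero    p₀ = contradiction p₀ ¬p₀
  least′ (suc k) pₖ = s≤s (least k pₖ)

-- Finiteness enters as exhaustive search, which passes from a type to vectors over it and hence to
-- tables.
Searchable : Set → Set₁
Searchable A = ∀ {P : Pred A 0ℓ} → Decidable P → Dec (∃ P)

searchVec : ∀ {A n} → Searchable A → Searchable (Vec A n)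
searchVec {n = zero}  _      P? = map′ ([] ,_) (λ { ([] , p) → p }) (P? [])
searchVec {n = suc n} search P? =
  map′ (λ (x , xs , p) → x ∷ xs , p) (λ { (x ∷ xs , p) → x , xs , p })
    (search (λ x → searchVec search (λ xs → P? (x ∷ xs))))

searchBool : Searchable Bool
searchBool P? = map′ (λ { (inj₁ p) → true , p ; (inj₂ p) → false , p })
  (λ { (true , p) → inj₁ p ; (false , p) → inj₂ p }) (P? true ⊎-dec P? false)

allDec : ∀ {A} → Searchable A → ∀ {P : Pred A 0ℓ} → Decidable P → Dec (∀ x → P x)
allDec search P? = map′ (λ ¬∃ x → decidable-stable (P? x) (λ ¬p → ¬∃ (x , ¬p)))
  (λ ∀p (x , ¬p) → ¬p (∀p x)) (¬? (search (¬? ∘ P?)))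

-- Orderings and colourings are replaced by finite tables, which makes
-- "N ⟶ (G ,≺ ord) for some ord" decidable, so that its least solution N exists.
Table : Set → ℕ → Set
Table A n = Vec (Vec A n) n

entry : ∀ {A n} → Table A n → Fin n → Fin n → A
entry T u v = Vec.lookup (Vec.lookup T u) v

table : ∀ {A n} → (Fin n → Fin n → A) → Table A n
table f = tabulate (λ u → tabulate (f u))

entry∘table : ∀ {A n} (f : Fin n → Fin n → A) u v → entry (table f) u v ≡ f u v
entry∘table f u v = trans (cong (λ row → Vec.lookup row v) (lookup∘tabulate _ u)) (lookup∘tabulate (f u) v)

module _ {n : ℕ} where

  Related : Table Bool n → Rel (Fin n) 0ℓ
  Related T u v = entry T u v ≡ true

  related? : ∀ T → Decidable₂ (Related T)
  related? T u v = entry T u v Bool.≟ true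

  -- The axioms as quantifiers over `Fin n`, in a form that `all?` decides.
  Linear : Rel (Fin n) 0ℓ → Set
  Linear _≺_ = (∀ u → ¬ u ≺ u) × (∀ u v w → u ≺ v → v ≺ w → u ≺ w) × (∀ u v → u ≡ v ⊎ u ≺ v ⊎ v ≺ u)

  linear? : ∀ {_≺_} → Decidable₂ _≺_ → Dec (Linear _≺_)
  linear? _≺?_ =
    all? (λ u → ¬? (u ≺? u)) ×-dec
    all? (λ u → all? (λ v → all? (λ w → (u ≺? v) →-dec ((v ≺? w) →-dec (u ≺? w))))) ×-dec
    all? (λ u → all? (λ v → (u Fin.≟ v) ⊎-dec ((u ≺? v) ⊎-dec (v ≺? u))))

  totalOrdering : ∀ {_≺_} → Linear _≺_ → TotalOrdering (Fin n)
  totalOrdering {_≺_} (irr , tr , total) = record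
    { _≺_                = _≺_
    ; isStrictTotalOrder = isStrictTotalOrderᶜ record
      { isEquivalence = isEquivalence
      ; trans         = tr _ _ _
      ; compare       = compare
      }
    }
    where
    compare : Trichotomous _≡_ _≺_
    compare u v with total u v
    ... | inj₁ refl         = tri≈ (irr u) refl (irr u)
    ... | inj₂ (inj₁ u≺v)   = tri< u≺v (λ { refl → irr u u≺v }) (λ v≺u → irr u (tr u v u u≺v v≺u))
    ... | inj₂ (inj₂ v≺u)   = tri> (λ u≺v → irr u (tr u v u u≺v v≺u)) (λ { refl → irr u v≺u }) v≺u

-- Ordered copies as monotone maps

module Image {n N} (f : Fin n → Fin N) where

  image : Subset N
  image = tabulate (λ x → does (any? (λ v → f v Fin.≟ x)))

  ∈-image⁺ : ∀ v → f v ∈ˢ image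
  ∈-image⁺ v = lookup⇒[]= (f v) image
    (trans (lookup∘tabulate _ (f v)) (dec-true (any? (λ w → f w Fin.≟ f v)) (v , refl)))

  ∈-image⁻ : ∀ {x} → x ∈ˢ image → ∃[ v ] f v ≡ x
  ∈-image⁻ {x} x∈
    with any? (λ v → f v Fin.≟ x)
       | trans (sym (lookup∘tabulate (λ y → does (any? (λ v → f v Fin.≟ y))) x)) ([]=⇒lookup x∈)
  ... | yes p | _  = p
  ... | no  _ | ()

module _ {n} (G : Graph (Fin n)) where
  open Graph G

  MonoCopy : ∀ {N} → Rel (Fin n) 0ℓ → (Fin N → Fin N → Fin 2) → Pred (Fin n → Fin N) 0ℓ
  MonoCopy _≺_ col f =
    (∀ u v → u ≺ v → f u Fin.< f v) × ∃[ i ] (∀ u v → Adj u v → col (f u) (f v) ≡ i)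

  -- `_⟶_` with maps in place of subgraphs, and with colourings that are symmetric functions on all
  -- pairs. This form lies in `Set` and can be tabulated.
  Arrows : ℕ → Rel (Fin n) 0ℓ → Set
  Arrows N _≺_ = (col : Fin N → Fin N → Fin 2) → (∀ x y → col x y ≡ col y x) → ∃ (MonoCopy _≺_ col)

  ⟶⇒Arrows : ∀ {N} (ord : TotalOrdering (Fin n)) → N ⟶ (G ,≺ ord) → Arrows N (TotalOrdering._≺_ ord)
  ⟶⇒Arrows {N} ord arrow col col-sym with arrow χ
    where
    χ : TwoColouring (OrderedGraph.graph (𝒦 N))
    χ = record { colour = λ {x} {y} _ → col x y ; colour-symm = λ {x} {y} _ _ → col-sym x y }
  ... | S , 𝒮 , 𝒮⊑𝒦 , (i , mono) , iso =
    (λ v → proj₁ (iso.to v)) ,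
    (λ u v u≺v → suborder (Equivalence.to (iso.preserves-≺ u v) u≺v)) ,
    i , λ u v a → mono (Equivalence.to (iso.preserves-Adj u v) a)
    where
    module iso = _≅_ iso
    open _⊑_ 𝒮⊑𝒦

  -- The copy lives on the image of `f`, with adjacency and order pulled back along `from`. Strict
  -- monotonicity on a total order makes `f` injective.
  Arrows⇒⟶ : ∀ {N} (ord : TotalOrdering (Fin n)) → Arrows N (TotalOrdering._≺_ ord) → N ⟶ (G ,≺ ord)
  Arrows⇒⟶ {N} ord arrows χ = copy (arrows col col-sym)
    where
    open TotalOrdering ord
    open IsStrictTotalOrder isStrictTotalOrder using (compare) renaming (trans to ≺-trans)
    open TwoColouring χ

    colour-irrelevant : ∀ {x y} (e e′ : x ≢ y) → colour e ≡ colour e′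
    colour-irrelevant e e′ = trans (colour-symm e (≢-sym e)) (colour-symm (≢-sym e) e′)

    col : Fin N → Fin N → Fin 2
    col x y with x Fin.≟ y
    -- A default colour on the diagonal, where `𝒦 N` has no edge.
    ... | yes _  = zero
    ... | no x≢y = colour x≢y

    col-colour : ∀ {x y} (e : x ≢ y) → col x y ≡ colour e
    col-colour {x} {y} e with x Fin.≟ y
    ... | yes x≡y = contradiction x≡y e
    ... | no x≢y  = colour-irrelevant x≢y e

    col-sym : ∀ x y → col x y ≡ col y x
    col-sym x y with x Fin.≟ y
    ... | no x≢y   = trans (colour-symm x≢y (≢-sym x≢y)) (sym (col-colour (≢-sym x≢y)))
    ... | yes refl with x Fin.≟ x
    ...   | yes _  = refl
    ...   | no x≢x = contradiction refl x≢x

    copy : ∃ (MonoCopy _≺_ col) → Σ[ S ∈ Subset N ] Σ[ 𝒮 ∈ OrderedGraph (Element S) ] Σ[ 𝒮⊑𝒦 ∈ 𝒮 ⊑ 𝒦 N ]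
           Monochromatic χ 𝒮⊑𝒦 × (G ,≺ ord) ≅ 𝒮
    copy (f , f-mono , i , f-mono-chromatic) = image , 𝒮 , 𝒮⊑𝒦 , mono , iso
      where
      open Image f

      f-injective : ∀ {u v} → f u ≡ f v → u ≡ v
      f-injective {u} {v} fu≡fv with compare u v
      ... | tri< u≺v _ _ = contradiction fu≡fv (Fin.<⇒≢ (f-mono u v u≺v))
      ... | tri≈ _ u≡v _ = u≡v
      ... | tri> _ _ v≺u = contradiction (sym fu≡fv) (Fin.<⇒≢ (f-mono v u v≺u))

      to : Fin n → Element image
      to v = f v , ∈-image⁺ v

      from : Element image → Fin n
      from (_ , x∈) = proj₁ (∈-image⁻ x∈)

      f∘from : ∀ x → f (from x) ≡ proj₁ x
      f∘from (_ , x∈) = proj₂ (∈-image⁻ x∈)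

      Element-≡ : ∀ {x y : Element image} → proj₁ x ≡ proj₁ y → x ≡ y
      Element-≡ {x , x∈} {.x , y∈} refl = cong (x ,_) ([]=-irrelevant x∈ y∈)

      from∘to : ∀ v → from (to v) ≡ v
      from∘to v = f-injective (f∘from (to v))

      from-injective : ∀ {x y} → from x ≡ from y → x ≡ y
      from-injective {x} {y} eq = Element-≡ (trans (sym (f∘from x)) (trans (cong f eq) (f∘from y)))

      𝒮 : OrderedGraph (Element image)
      𝒮 = record
        { graph = record
          { Adj    = λ x y → Adj (from x) (from y)
          ; adj?   = λ x y → adj? (from x) (from y)
          ; symm   = symm
          ; irrefl = irrefl
          }
        ; ordering = record
          { _≺_                = λ x y → from x ≺ from y
          ; isStrictTotalOrder = isStrictTotalOrderᶜ record
            { isEquivalence = isEquivalence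
            ; trans         = ≺-trans
            ; compare       = compare′
            }
          }
        }
        where
        compare′ : Trichotomous _≡_ (λ x y → from x ≺ from y)
        compare′ x y with compare (from x) (from y)
        ... | tri< a ¬b ¬c = tri< a (¬b ∘ cong from) ¬c
        ... | tri≈ ¬a b ¬c = tri≈ ¬a (from-injective b) ¬c
        ... | tri> ¬a ¬b c = tri> ¬a (¬b ∘ cong from) c

      𝒮⊑𝒦 : 𝒮 ⊑ 𝒦 N
      𝒮⊑𝒦 = record
        -- Elements over the same host vertex are equal, so an edge between them would be a loop.
        { subgraph = λ {x} {y} a x≡y →
            irrefl (subst (λ z → Adj (from x) (from z)) (sym (Element-≡ {x} {y} x≡y)) a)
        ; suborder = λ {x} {y} x≺y → subst₂ Fin._<_ (f∘from x) (f∘from y) (f-mono _ _ x≺y)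
        }

      mono : Monochromatic χ 𝒮⊑𝒦
      mono = i , λ {x} {y} a → trans (sym (col-colour _))
        (trans (cong₂ col (sym (f∘from x)) (sym (f∘from y))) (f-mono-chromatic _ _ a))

      iso : (G ,≺ ord) ≅ 𝒮
      iso = record
        { bijection     = mk↔ₛ′ to from (λ x → Element-≡ (f∘from x)) from∘to
        ; preserves-Adj = λ u v → transport Adj u v
        ; preserves-≺   = λ u v → transport _≺_ u v
        }
        where
        transport : ∀ (R : Rel (Fin n) 0ℓ) u v → R u v ⇔ R (from (to u)) (from (to v))
        transport R u v = mk⇔ (subst₂ R (sym (from∘to u)) (sym (from∘to v))) (subst₂ R (from∘to u) (from∘to v))

  -- Decidability through finite tables

  TableArrows : ℕ → Rel (Fin n) 0ℓ → Set
  TableArrows N _≺_ = (M : Table (Fin 2) N) → (∀ x y → entry M x y ≡ entry M y x) →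
    Σ[ F ∈ Vec (Fin N) n ] MonoCopy _≺_ (entry M) (Vec.lookup F)

  tableArrows? : ∀ N {_≺_} → Decidable₂ _≺_ → Dec (TableArrows N _≺_)
  tableArrows? N _≺?_ = allDec (searchVec (searchVec any?)) λ M →
    all? (λ x → all? (λ y → entry M x y Fin.≟ entry M y x)) →-dec
    searchVec any? (λ F →
      all? (λ u → all? (λ v → (u ≺? v) →-dec (Vec.lookup F u Fin.<? Vec.lookup F v))) ×-dec
      any? (λ i → all? (λ u → all? (λ v → adj? u v →-dec (entry M (Vec.lookup F u) (Vec.lookup F v) Fin.≟ i)))))

  TableArrows⇒Arrows : ∀ {N} {_≺_} → TableArrows N _≺_ → Arrows N _≺_
  TableArrows⇒Arrows arrows col col-sym
    with F , mono , i , chromatic ← arrows (table col)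
           (λ x y → trans (entry∘table col x y) (trans (col-sym x y) (sym (entry∘table col y x))))
    = Vec.lookup F , mono , i , λ u v a → trans (sym (entry∘table col _ _)) (chromatic u v a)

  -- A map monotone along `_≺_` is monotone along any relation contained in it, so one inclusion
  -- suffices to pass to the tabulated order.
  Arrows⇒TableArrows : ∀ {N} {_≺_ _≺′_} → (∀ {u v} → u ≺′ v → u ≺ v) → Arrows N _≺_ → TableArrows N _≺′_
  Arrows⇒TableArrows ≺′⇒≺ arrows M M-sym with f , mono , i , chromatic ← arrows (entry M) M-sym =
    tabulate f ,
    (λ u v u≺v → subst₂ Fin._<_ (sym (lookup∘tabulate f u)) (sym (lookup∘tabulate f v)) (mono u v (≺′⇒≺ u≺v))) ,
    i , λ u v a → trans (cong₂ (entry M) (lookup∘tabulate f u) (lookup∘tabulate f v)) (chromatic u v a)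

  SomeOrderArrows : Pred ℕ 0ℓ
  SomeOrderArrows N = Σ[ T ∈ Table Bool n ] Linear (Related T) × TableArrows N (Related T)

  someOrderArrows? : Decidable SomeOrderArrows
  someOrderArrows? N = searchVec (searchVec searchBool)
    (λ T → linear? (related? T) ×-dec tableArrows? N (related? T))

  someOrderArrows⁺ : ∀ {N} (ord : TotalOrdering (Fin n)) → N ⟶ (G ,≺ ord) → SomeOrderArrows N
  someOrderArrows⁺ ord arrow = T , (irr , tr , total) , Arrows⇒TableArrows related⇒≺ (⟶⇒Arrows ord arrow)
    where
    open TotalOrdering ord
    open IsStrictTotalOrder isStrictTotalOrder using (compare; _<?_) renaming (trans to ≺-trans; irrefl to ≺-irrefl)

    T : Table Bool n
    -- A strict total order is decidable by trichotomy and so has a truth table.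
    T = table (λ u v → does (u <? v))

    ≺⇒related : ∀ {u v} → u ≺ v → Related T u v
    ≺⇒related {u} {v} u≺v = trans (entry∘table _ u v) (dec-true (u <? v) u≺v)

    related⇒≺ : ∀ {u v} → Related T u v → u ≺ v
    related⇒≺ {u} {v} r with u <? v | trans (sym (entry∘table (λ u v → does (u <? v)) u v)) r
    ... | yes u≺v | _  = u≺v
    ... | no _    | ()

    irr : ∀ u → ¬ Related T u u
    irr u = ≺-irrefl refl ∘ related⇒≺

    tr : ∀ u v w → Related T u v → Related T v w → Related T u w
    tr u v w r s = ≺⇒related (≺-trans (related⇒≺ r) (related⇒≺ s))

    total : ∀ u v → u ≡ v ⊎ Related T u v ⊎ Related T v u
    total u v with compare u v
    ... | tri< u≺v _ _ = inj₂ (inj₁ (≺⇒related u≺v))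
    ... | tri≈ _ u≡v _ = inj₁ u≡v
    ... | tri> _ _ v≺u = inj₂ (inj₂ (≺⇒related v≺u))

  -- One minimisation yields both minima: let `m` be least such that some ordering arrows. Anything
  -- that the ordering found at `m` arrows from is at least `m`, so its ordered Ramsey number is
  -- exactly `m`, and no ordering has a smaller one.
  minR̄-≤ : ∀ {N} (ord : TotalOrdering (Fin n)) → N ⟶ (G ,≺ ord) → ∃[ m ] IsMinR̄ G m × m ≤ N
  minR̄-≤ {N} ord arrow
    with m , (T , linear , arrows) , least ← minimum someOrderArrows? N (someOrderArrows⁺ ord arrow)
    = m ,
      ((totalOrdering linear , Arrows⇒⟶ (totalOrdering linear) (TableArrows⇒Arrows arrows) ,
        λ k arrowₖ → least k (someOrderArrows⁺ (totalOrdering linear) arrowₖ)) ,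
       λ k (ordₖ , arrowₖ , _) → least k (someOrderArrows⁺ ordₖ arrowₖ)) ,
      least N (someOrderArrows⁺ ord arrow)

-- The bound

-- Strong induction: `n` is at most twice `⌈ n /2⌉`, whose logarithm is one less.
n≤2^⌈log₂n⌉ : ∀ n → n ≤ 2 ^ ⌈log₂ n ⌉
n≤2^⌈log₂n⌉ = <-rec (λ n → n ≤ 2 ^ ⌈log₂ n ⌉) step
  where
  open ≤-Reasoning
  step : ∀ n → (∀ {m} → m < n → m ≤ 2 ^ ⌈log₂ m ⌉) → n ≤ 2 ^ ⌈log₂ n ⌉
  step 0               _   = z≤n
  step 1               _   = ℕ.m^n>0 2 ⌈log₂ 1 ⌉
  step n@(suc (suc m)) rec = begin
    n                           ≡⟨ ℕ.⌊n/2⌋+⌈n/2⌉≡n n ⟨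
    ⌊ n /2⌋ + ⌈ n /2⌉           ≤⟨ ℕ.+-monoˡ-≤ ⌈ n /2⌉ (ℕ.⌊n/2⌋≤⌈n/2⌉ n) ⟩
    ⌈ n /2⌉ + ⌈ n /2⌉           ≡⟨ cong (⌈ n /2⌉ +_) (ℕ.+-identityʳ ⌈ n /2⌉) ⟨
    2 * ⌈ n /2⌉                 ≤⟨ ℕ.*-monoʳ-≤ 2 (rec (ℕ.⌈n/2⌉<n m)) ⟩
    2 ^ suc ⌈log₂ ⌈ n /2⌉ ⌉     ≡⟨ cong (λ k → 2 ^ suc k) (⌈log₂⌈n/2⌉⌉≡⌈log₂n⌉∸1 n) ⟩
    -- The truncated subtraction is exact, because `n ≥ 2` makes the logarithm at least 1.
    2 ^ suc (⌈log₂ n ⌉ ∸ 1)     ≡⟨ cong (2 ^_) (ℕ.m+[n∸m]≡n (⌈log₂⌉-mono-≤ {2} {n} (s≤s (s≤s z≤n)))) ⟩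
    2 ^ ⌈log₂ n ⌉               ∎

^-distribʳ-* : ∀ m n k → (m * n) ^ k ≡ m ^ k * n ^ k
^-distribʳ-* m n zero    = refl
^-distribʳ-* m n (suc k) = trans (cong (m * n *_) (^-distribʳ-* m n k)) (ℕ.[m*n]*[o*p]≡[m*o]*[n*p] m n (m ^ k) (n ^ k))

degree≤maxDegree : ∀ {n} (G : Graph (Fin n)) v → degree G v ≤ maxDegree G
degree≤maxDegree {n} G v = All.lookup (xs≤max 0 (map (degree G) (allFin n))) (∈-map⁺ (degree G) (∈-allFin v))

-- The constant factor per level: 2 from halving, `Δ + 1` from the number of cells, `Δ + 1` from the
-- greedy choice, and the rest from `q ^ Δ`.
growth : ℕ → ℕ → ℕ
growth Δ L = 2 * suc Δ * suc Δ * (2 ^ suc L) ^ Δ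

module _ {n Δ} .{{_ : NonZero n}} (G : Graph (Fin n)) (bound : ∀ v → degree G v ≤ Δ)
         (c : Fin n → Fin (suc Δ)) (proper : ∀ {u v} → Graph.Adj G u v → c u ≢ c v) (L : ℕ) where
  open Dichotomy G bound c proper L

  -- Each level also contributes `n ^ (Δ + 1)`: one factor `n` from the number of cells and `Δ` from
  -- `q ^ Δ`. The final `+ 1` is the base case `n`.
  hostSize≡ : ∀ ℓ → hostSize ℓ ≡ growth Δ L ^ ℓ * n ^ ((Δ + 1) * ℓ + 1)
  hostSize≡ zero    = sym (trans (ℕ.+-identityʳ _)
    (trans (cong (λ k → n ^ (k + 1)) (ℕ.*-zeroʳ (Δ + 1))) (ℕ.*-identityʳ n)))
  hostSize≡ (suc ℓ) = begin
    suc Δ * n * (suc Δ * (2 * hostSize ℓ) * q ^ Δ)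
      ≡⟨ cong₂ (λ h k → suc Δ * n * (suc Δ * (2 * h) * k)) (hostSize≡ ℓ) (^-distribʳ-* (2 ^ suc L) n Δ) ⟩
    suc Δ * n * (suc Δ * (2 * (growth Δ L ^ ℓ * n ^ e)) * ((2 ^ suc L) ^ Δ * n ^ Δ))
      ≡⟨ rearrange (suc Δ) n (growth Δ L ^ ℓ) (n ^ e) ((2 ^ suc L) ^ Δ) (n ^ Δ) ⟩
    growth Δ L * growth Δ L ^ ℓ * (n ^ suc Δ * n ^ e)
      ≡⟨ cong (growth Δ L ^ suc ℓ *_) (ℕ.^-distribˡ-+-* n (suc Δ) e) ⟨
    growth Δ L ^ suc ℓ * n ^ (suc Δ + e)
      ≡⟨ cong (λ k → growth Δ L ^ suc ℓ * n ^ k) (exponent Δ ℓ) ⟩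
    growth Δ L ^ suc ℓ * n ^ ((Δ + 1) * suc ℓ + 1)
      ∎
    where
    open ≡-Reasoning
    e = (Δ + 1) * ℓ + 1

    rearrange : ∀ d n k m p r → d * n * (d * (2 * (k * m)) * (p * r)) ≡ 2 * d * d * p * k * (n * r * m)
    rearrange = solve-∀

    exponent : ∀ Δ ℓ → suc Δ + ((Δ + 1) * ℓ + 1) ≡ (Δ + 1) * suc ℓ + 1
    exponent = solve-∀

  keyOrdering : TotalOrdering (Fin n)
  keyOrdering = totalOrdering {_≺_ = λ u v → key u Fin.< key v}
    ((λ _ → Fin.<-irrefl refl) , (λ _ _ _ → Fin.<-trans) , total)
    where
    total : ∀ u v → u ≡ v ⊎ key u Fin.< key v ⊎ key v Fin.< key u
    total u v with Fin.<-cmp (key u) (key v)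
    ... | tri< u<v _ _ = inj₂ (inj₁ u<v)
    ... | tri≈ _ u≡v _ = inj₁ (Fin.combine-injectiveʳ (c u) u (c v) v u≡v)
    ... | tri> _ _ v<u = inj₂ (inj₂ v<u)

  hostSize-⟶ : suc Δ ≤ 2 ^ L → hostSize L ⟶ (G ,≺ keyOrdering)
  hostSize-⟶ p≤2^L = Arrows⇒⟶ G keyOrdering arrows
    where
    arrows : Arrows G (hostSize L) (TotalOrdering._≺_ keyOrdering)
    arrows col col-sym with redCopy⊎blueCopy {Red = λ x y → col x y ≡ zero} (λ x y → col x y Fin.≟ zero)
                              (λ {x} {y} red → trans (col-sym y x) red) p≤2^L ℕ.≤-refl
    ... | inj₁ (f , mono , red)  = f , (λ u v → mono) , zero , λ u v → red
    ... | inj₂ (f , mono , blue) = f , (λ u v → mono) , suc zero , λ u v a → ≢zero (blue a)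
      where
      ≢zero : {i : Fin 2} → i ≢ zero → i ≡ suc zero
      ≢zero {zero}     i≢0 = contradiction refl i≢0
      ≢zero {suc zero} _   = refl

minR̄-bound : ∀ {n Δ} .{{_ : NonZero n}} (G : Graph (Fin n)) → (∀ v → degree G v ≤ Δ) →
              ∀ L → suc Δ ≤ 2 ^ L →
              ∃[ m ] (IsMinR̄ G m × m ≤ growth Δ L ^ L * n ^ ((Δ + 1) * L + 1))
minR̄-bound {n} G bound L p≤2^L =
  let c , proper     = Neighbours.properColouring G (allFin n) bound
      proper′        = λ {u} {v} → proper (∈-allFin u) (∈-allFin v)
      m , isMin , m≤ = minR̄-≤ G (keyOrdering G bound c proper′ L) (hostSize-⟶ G bound c proper′ L p≤2^L)
  in m , isMin , ℕ.≤-trans m≤ (ℕ.≤-reflexive (hostSize≡ G bound c proper′ L L))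

corollary3p4 : (Δ : ℕ) → .{{_ : NonZero Δ}} →
    ∃[ C ] ((n : ℕ) (G : Graph (Fin n)) → maxDegree G ≡ Δ →
    ∃[ m ] (IsMinR̄ G m × m ≤ C * n ^ ((Δ + 1) * ⌈log₂ (Δ + 1) ⌉ + 1)))
-- The constant is `growth Δ L ^ L` with `L = ⌈log₂ (Δ + 1) ⌉`, which depends on `Δ` alone.
corollary3p4 Δ = growth Δ ⌈log₂ (Δ + 1) ⌉ ^ ⌈log₂ (Δ + 1) ⌉ , λ where
  -- The empty graph has maximum degree 0, but `Δ` is positive.
  zero      _ 0≡Δ  → contradiction (sym 0≡Δ) (≢-nonZero⁻¹ Δ)
  n@(suc _) G refl → minR̄-bound G (degree≤maxDegree G) ⌈log₂ (Δ + 1) ⌉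
    (subst (_≤ 2 ^ ⌈log₂ (Δ + 1) ⌉) (ℕ.+-comm Δ 1) (n≤2^⌈log₂n⌉ (Δ + 1)))
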